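{- For every $n\ge 1$, the number of noncrossing arc diagrams on $n$ points all of whose arcs are left arcs or right arcs equals the Baxter number \[B(n)=\binom{n+1}{1}^{ -1}\binom{n+1}{2}^{ -1}\sum_{k=0}^{n-1}\binom{n+1}{k}\binom{n+1}{k+1}\binom{n+1}{k+2}.\]
   Context: Place $n$ distinct points on a vertical line, identified with $1,\ldots,n$ from bottom to top. An arc connects a point $p$ to a strictly higher point $q$, moving monotonically upward from $p$ to $q$ and passing either to the left or to the right of each point strictly between $p$ and $q$ (it may pass left of some and right of others). Arcs are considered only up to combinatorial equivalence: an arc is determined by its two endpoints and by which of the points strictly between them lie to its left. A noncrossing arc diagram on $n$ points is a collection of (zero or more) such arcs drawn so that (C1) no two arcs intersect except possibly at their endpoints, and (C2) no two arcs share the same upper endpoint or the same lower endpoint; diagrams are considered up to combinatorial equivalence, i.e. a diagram is determined by which pairs of points are joined by arcs and which points are left/right of each arc. A left arc is an arc that does not pass to the right of any point; a right arc is an arc that does not pass to the left of any point. -}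

module Defs where

open import Data.Nat using (ℕ; zero; suc; _+_; _*_; _∸_; _≤_; _<_)
open import Data.Nat.Combinatorics using (_C_)
open import Data.List using (List; []; _∷_; length; map; upTo)
open import Data.Nat.ListAction using (sum)
open import Data.Sum using (_⊎_)
open import Data.List.Relation.Unary.All using (All)
open import Data.List.Relation.Unary.Linked using (Linked)
open import Data.List.Relation.Unary.AllPairs using (AllPairs)
open import Data.Maybe using (Maybe; just; nothing)
open import Data.Fin using (Fin)
open import Data.Product using (Σ; ∃; _×_)
open import Relation.Binary.PropositionalEquality using (_≡_; _≢_)
open import Relation.Nullary using (¬_)

-- Points on the vertical line are the natural numbers 1, ..., n (bottom to top).

data Side : Set where
  passL : Side   -- arc passes to the LEFT of the point (the point lies to its right)
  passR : Side   -- arc passes to the RIGHT of the point (the point lies to its left)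

-- An arc, up to combinatorial equivalence: its lower endpoint, upper endpoint,
-- and the list of sides for the points lo+1, lo+2, ..., hi-1 (in this order).
record Arc : Set where
  constructor arc
  field
    lo    : ℕ
    hi    : ℕ
    sides : List Side
open Arc public

WellFormedArc : ℕ → Arc → Set
WellFormedArc n α = (1 ≤ lo α) × (lo α < hi α) × (hi α ≤ n)
                    × (length (sides α) ≡ hi α ∸ lo α ∸ 1)

nth : {A : Set} → List A → ℕ → Maybe A
nth []       _       = nothing
nth (x ∷ xs) zero    = just x
nth (x ∷ xs) (suc k) = nth xs k

-- Horizontal position of an arc at an integer height, relative to the
-- point at that height: left of it, at it, or right of it.
data Pos : Set where
  left on right : Pos

data _<ₚ_ : Pos → Pos → Set where
  l<o : left <ₚ on
  l<r : left <ₚ right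
  o<r : on <ₚ right

sidePos : Side → Pos
sidePos passL = left
sidePos passR = right

data PosAt (α : Arc) : ℕ → Pos → Set where
  atLo    : PosAt α (lo α) on
  atHi    : PosAt α (hi α) on
  between : ∀ {i s} → lo α < i → i < hi α →
            nth (sides α) (i ∸ suc (lo α)) ≡ just s → PosAt α i (sidePos s)

LeftAt : Arc → Arc → ℕ → Set
LeftAt α β i = Σ Pos λ x → Σ Pos λ y → PosAt α i x × PosAt β i y × (x <ₚ y)

-- Two arcs cross (cannot be drawn without intersecting except at common
-- endpoints) iff at some height α is forced left of β and at some height
-- β is forced left of α.
Crosses : Arc → Arc → Set
Crosses α β = Σ ℕ λ i → Σ ℕ λ j → LeftAt α β i × LeftAt β α j

-- A noncrossing arc diagram on n points, represented canonically as the
-- list of its arcs sorted by strictly increasing lower endpoint (this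
-- strict sorting also expresses "no two arcs share a lower endpoint").
NoncrossingArcDiagram : ℕ → List Arc → Set
NoncrossingArcDiagram n D =
    All (WellFormedArc n) D
  × Linked (λ α β → lo α < lo β) D
  × AllPairs (λ α β → hi α ≢ hi β) D
  × AllPairs (λ α β → ¬ Crosses α β) D

LeftArc : Arc → Set
LeftArc α = All (_≡ passL) (sides α)

RightArc : Arc → Set
RightArc α = All (_≡ passR) (sides α)

LeftRightDiagram : ℕ → List Arc → Set
LeftRightDiagram n D =
  NoncrossingArcDiagram n D × All (λ α → LeftArc α ⊎ RightArc α) D

HasCardinality : {A : Set} → (A → Set) → ℕ → Set
HasCardinality {A} P m =
  Σ (Fin m → A) λ f →
      (∀ i j → f i ≡ f j → i ≡ j)
    × (∀ i → P (f i))
    × (∀ x → P x → ∃ λ i → f i ≡ x)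

baxterSum : ℕ → ℕ
baxterSum n = sum (map (λ k → ((n + 1) C k) * ((n + 1) C (k + 1)) * ((n + 1) C (k + 2))) (upTo n))

{-# OPTIONS --safe #-}
module Submission where

-- Sweep the gaps between consecutive points from bottom to top and record the numbers (i , j) of left
-- and right arcs above the current point that still have to end. Arcs on the same side are nested or
-- consecutive, and arcs on opposite sides never cross, so a diagram is the same as a closed walk of
-- n - 1 steps at the corner of the quarter plane, with steps (±1 , 0), (0 , ±1), (1 , -1), (-1 , 1) and
-- two kinds of (0 , 0): nothing happens, or an arc joins the two consecutive points. Such a walk is a
-- triple of vicious walkers at distances i + 1 and j + 1, because the step polynomial factors as
-- (1 + x)(1 + y/x)(1 + 1/y). By the reflection principle the walks in which the last walker moves k
-- times are counted by a 3 × 3 Toeplitz determinant of binomial coefficients, and this determinant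
-- evaluates to the k-th summand of the Baxter number.

-- Algebra of 3 × 3 determinants

module DeterminantAlgebra where
  open import Data.Nat using (ℕ)
  open import Data.Integer
  open import Data.Integer.Tactic.RingSolver using (solve-∀)
  open import Relation.Binary.PropositionalEquality

  Row : Set
  Row = ℕ → ℤ

  det : Row → Row → Row → ℤ
  det u v w = u 0 * (v 1 * w 2 - v 2 * w 1) - u 1 * (v 0 * w 2 - v 2 * w 0) + u 2 * (v 0 * w 1 - v 1 * w 0)

  det-zero₁ : ∀ u v w → u 0 ≡ 0ℤ → u 1 ≡ 0ℤ → u 2 ≡ 0ℤ → det u v w ≡ 0ℤ
  det-zero₁ u v w e₀ e₁ e₂ rewrite e₀ | e₁ | e₂ = refl

  det-zero₃ : ∀ u v w → w 0 ≡ 0ℤ → w 1 ≡ 0ℤ → w 2 ≡ 0ℤ → det u v w ≡ 0ℤ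
  det-zero₃ u v w e₀ e₁ e₂ rewrite e₀ | e₁ | e₂ = vanish (u 0) (u 1) (u 2) (v 0) (v 1) (v 2)
    where
    vanish : ∀ a b c d e f → a * (e * 0ℤ - f * 0ℤ) - b * (d * 0ℤ - f * 0ℤ) + c * (d * 0ℤ - e * 0ℤ) ≡ 0ℤ
    vanish = solve-∀

  det-equal₁₂ : ∀ u w → det u u w ≡ 0ℤ
  det-equal₁₂ u w = vanish (u 0) (u 1) (u 2) (w 0) (w 1) (w 2)
    where
    vanish : ∀ a b c d e f → a * (b * f - c * e) - b * (a * f - c * d) + c * (a * e - b * d) ≡ 0ℤ
    vanish = solve-∀

  det-equal₂₃ : ∀ u v → det u v v ≡ 0ℤ
  det-equal₂₃ u v = vanish (u 0) (u 1) (u 2) (v 0) (v 1) (v 2)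
    where
    vanish : ∀ a b c d e f → a * (e * f - f * e) - b * (d * f - f * d) + c * (d * e - e * d) ≡ 0ℤ
    vanish = solve-∀

  -- Multilinearity in the three rows. The eight terms are ordered and bracketed as in `sum-steps`:
  -- `skip`, `short`, `openL`, `openR`, the pair of `downL`, the pair of `downR`.
  det-additive : ∀ {u v w} (u₀ u₁ v₀ v₁ w₀ w₁ : Row) →
                 (∀ t → u t ≡ u₀ t + u₁ t) → (∀ t → v t ≡ v₀ t + v₁ t) → (∀ t → w t ≡ w₀ t + w₁ t) →
    det u v w ≡ det u₀ v₀ w₀ + (det u₁ v₁ w₁ + (det u₁ v₁ w₀ + (det u₁ v₀ w₀ +
                ((det u₀ v₀ w₁ + det u₁ v₀ w₁) + (det u₀ v₁ w₁ + det u₀ v₁ w₀)))))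
  det-additive u₀ u₁ v₀ v₁ w₀ w₁ eu ev ew
    rewrite eu 0 | eu 1 | eu 2 | ev 0 | ev 1 | ev 2 | ew 0 | ew 1 | ew 2 =
    expand (u₀ 0) (u₀ 1) (u₀ 2) (u₁ 0) (u₁ 1) (u₁ 2) (v₀ 0) (v₀ 1) (v₀ 2) (v₁ 0) (v₁ 1) (v₁ 2)
           (w₀ 0) (w₀ 1) (w₀ 2) (w₁ 0) (w₁ 1) (w₁ 2)
    where
    expand : ∀ a b c a′ b′ c′ d e f d′ e′ f′ g h i g′ h′ i′ →
      (a + a′) * ((e + e′) * (i + i′) - (f + f′) * (h + h′)) - (b + b′) * ((d + d′) * (i + i′) - (f + f′) * (g + g′))
        + (c + c′) * ((d + d′) * (h + h′) - (e + e′) * (g + g′)) ≡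
      (a * (e * i - f * h) - b * (d * i - f * g) + c * (d * h - e * g)) +
      ((a′ * (e′ * i′ - f′ * h′) - b′ * (d′ * i′ - f′ * g′) + c′ * (d′ * h′ - e′ * g′)) +
      ((a′ * (e′ * i - f′ * h) - b′ * (d′ * i - f′ * g) + c′ * (d′ * h - e′ * g)) +
      ((a′ * (e * i - f * h) - b′ * (d * i - f * g) + c′ * (d * h - e * g)) +
      (((a * (e * i′ - f * h′) - b * (d * i′ - f * g′) + c * (d * h′ - e * g′)) +
      (a′ * (e * i′ - f * h′) - b′ * (d * i′ - f * g′) + c′ * (d * h′ - e * g′))) +
      ((a * (e′ * i′ - f′ * h′) - b * (d′ * i′ - f′ * g′) + c * (d′ * h′ - e′ * g′)) +
      (a * (e′ * i - f′ * h) - b * (d′ * i - f′ * g) + c * (d′ * h - e′ * g)))))))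
    expand = solve-∀

  -- The hypotheses are those satisfied by a = C(N, k-2), b = C(N, k-1), c = C(N, k), d = C(N, k+1) and
  -- e = C(N, k+2) for K = k and M = N - k; scaling clears the denominators of a, b, d, e relative to c.
  module _ (M K a b c d e : ℤ)
    (ha : (+ 2 + M) * ((1ℤ + M) * a) ≡ (K - 1ℤ) * (K * c))
    (hb : (1ℤ + M) * b ≡ K * c)
    (hd : (1ℤ + K) * d ≡ M * c)
    (he : (+ 2 + K) * ((1ℤ + K) * e) ≡ (M - 1ℤ) * (M * c)) where

    scaling toeplitz : ℤ
    scaling  = (1ℤ + M) * (1ℤ + M) * (+ 2 + M) * ((1ℤ + K) * (1ℤ + K) * (+ 2 + K))
    toeplitz = c * (c * c - b * d) - b * (d * c - b * e) + a * (d * d - c * e)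

    combination : (a₂ b₁ d₁ e₂ : ℤ) → ℤ
    combination a₂ b₁ d₁ e₂ =
      (1ℤ + M) * (1ℤ + M) * (+ 2 + M) * ((1ℤ + K) * (1ℤ + K) * (+ 2 + K)) * (c * c * c)
      - + 2 * ((1ℤ + M) * (+ 2 + M) * ((1ℤ + K) * (+ 2 + K))) * (c * b₁ * d₁)
      + (+ 2 + M) * (1ℤ + K) * (b₁ * b₁ * e₂)
      + (1ℤ + M) * (+ 2 + K) * (a₂ * (d₁ * d₁))
      - (1ℤ + M) * (1ℤ + K) * (a₂ * c * e₂)

    -- After multiplication by `scaling`, every monomial can be written in the scaled entries that
    -- the hypotheses express through `c`; each becomes a polynomial in `M` and `K` times the cube
    -- of `c`.
    toeplitz-det : scaling * toeplitz ≡ + 2 * ((1ℤ + M + K) * (1ℤ + M + K) * (+ 2 + M + K)) * (c * c * c)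
    toeplitz-det = trans (scale M K a b c d e) (trans (substitute ha hb hd he) (collect M K c))
      where
      scale : ∀ M K a b c d e →
        (1ℤ + M) * (1ℤ + M) * (+ 2 + M) * ((1ℤ + K) * (1ℤ + K) * (+ 2 + K)) *
          (c * (c * c - b * d) - b * (d * c - b * e) + a * (d * d - c * e)) ≡
        (1ℤ + M) * (1ℤ + M) * (+ 2 + M) * ((1ℤ + K) * (1ℤ + K) * (+ 2 + K)) * (c * c * c)
        - + 2 * ((1ℤ + M) * (+ 2 + M) * ((1ℤ + K) * (+ 2 + K))) * (c * ((1ℤ + M) * b) * ((1ℤ + K) * d))
        + (+ 2 + M) * (1ℤ + K) * (((1ℤ + M) * b) * ((1ℤ + M) * b) * ((+ 2 + K) * ((1ℤ + K) * e)))
        + (1ℤ + M) * (+ 2 + K) * (((+ 2 + M) * ((1ℤ + M) * a)) * (((1ℤ + K) * d) * ((1ℤ + K) * d)))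
        - (1ℤ + M) * (1ℤ + K) * (((+ 2 + M) * ((1ℤ + M) * a)) * c * ((+ 2 + K) * ((1ℤ + K) * e)))
      scale = solve-∀
      substitute : ∀ {a₂ b₁ d₁ e₂ a₂′ b₁′ d₁′ e₂′} → a₂ ≡ a₂′ → b₁ ≡ b₁′ → d₁ ≡ d₁′ → e₂ ≡ e₂′ →
                   combination a₂ b₁ d₁ e₂ ≡ combination a₂′ b₁′ d₁′ e₂′
      substitute refl refl refl refl = refl
      collect : ∀ M K c →
        (1ℤ + M) * (1ℤ + M) * (+ 2 + M) * ((1ℤ + K) * (1ℤ + K) * (+ 2 + K)) * (c * c * c)
        - + 2 * ((1ℤ + M) * (+ 2 + M) * ((1ℤ + K) * (+ 2 + K))) * (c * (K * c) * (M * c))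
        + (+ 2 + M) * (1ℤ + K) * ((K * c) * (K * c) * ((M - 1ℤ) * (M * c)))
        + (1ℤ + M) * (+ 2 + K) * (((K - 1ℤ) * (K * c)) * ((M * c) * (M * c)))
        - (1ℤ + M) * (1ℤ + K) * (((K - 1ℤ) * (K * c)) * c * ((M - 1ℤ) * (M * c)))
        ≡ + 2 * ((1ℤ + M + K) * (1ℤ + M + K) * (+ 2 + M + K)) * (c * c * c)
      collect = solve-∀

    -- Pascal's rule applied twice: the sums in `product₀`, `product₁`, `product₂` stand for C(N+2,
    -- k), C(N+2, k+1), C(N+2, k+2), the factors of a Baxter summand.
    product₀ : (+ 2 + M) * (1ℤ + M) * ((c + b) + (b + a)) ≡ (1ℤ + M + K) * (+ 2 + M + K) * c
    product₀ = trans (split M a b c)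
      (trans (cong₂ (λ x y → (+ 2 + M) * (1ℤ + M) * c + + 2 * (+ 2 + M) * x + y) hb ha) (collect M K c))
      where
      split : ∀ M a b c → (+ 2 + M) * (1ℤ + M) * ((c + b) + (b + a)) ≡
              (+ 2 + M) * (1ℤ + M) * c + + 2 * (+ 2 + M) * ((1ℤ + M) * b) + (+ 2 + M) * ((1ℤ + M) * a)
      split = solve-∀
      collect : ∀ M K c → (+ 2 + M) * (1ℤ + M) * c + + 2 * (+ 2 + M) * (K * c) + (K - 1ℤ) * (K * c) ≡
                (1ℤ + M + K) * (+ 2 + M + K) * c
      collect = solve-∀

    product₁ : (1ℤ + M) * (1ℤ + K) * ((d + c) + (c + b)) ≡ (1ℤ + M + K) * (+ 2 + M + K) * c
    product₁ = trans (split M K b c d)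
      (trans (cong₂ (λ x y → (1ℤ + M) * y + + 2 * ((1ℤ + M) * (1ℤ + K)) * c + (1ℤ + K) * x) hb hd)
             (collect M K c))
      where
      split : ∀ M K b c d → (1ℤ + M) * (1ℤ + K) * ((d + c) + (c + b)) ≡
              (1ℤ + M) * ((1ℤ + K) * d) + + 2 * ((1ℤ + M) * (1ℤ + K)) * c + (1ℤ + K) * ((1ℤ + M) * b)
      split = solve-∀
      collect : ∀ M K c → (1ℤ + M) * (M * c) + + 2 * ((1ℤ + M) * (1ℤ + K)) * c + (1ℤ + K) * (K * c) ≡
                (1ℤ + M + K) * (+ 2 + M + K) * c
      collect = solve-∀

    product₂ : (+ 2 + K) * (1ℤ + K) * ((e + d) + (d + c)) ≡ (1ℤ + M + K) * (+ 2 + M + K) * c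
    product₂ = trans (split K c d e)
      (trans (cong₂ (λ x y → (+ 2 + K) * (1ℤ + K) * c + + 2 * (+ 2 + K) * x + y) hd he) (collect M K c))
      where
      split : ∀ K c d e → (+ 2 + K) * (1ℤ + K) * ((e + d) + (d + c)) ≡
              (+ 2 + K) * (1ℤ + K) * c + + 2 * (+ 2 + K) * ((1ℤ + K) * d) + (+ 2 + K) * ((1ℤ + K) * e)
      split = solve-∀
      collect : ∀ M K c → (+ 2 + K) * (1ℤ + K) * c + + 2 * (+ 2 + K) * (M * c) + (M - 1ℤ) * (M * c) ≡
                (1ℤ + M + K) * (+ 2 + M + K) * c
      collect = solve-∀

    -- `T` stands for C(N+2, 2), given through its double to avoid division. Both sides equal twice
    -- the cube of (1 + M + K)(2 + M + K)c.
    scaled-identity : ∀ T → + 2 * T ≡ (+ 2 + M + K) * (1ℤ + M + K) →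
      + 2 * scaling * (toeplitz * (+ 2 + M + K) * T) ≡
      + 2 * scaling * (((c + b) + (b + a)) * ((d + c) + (c + b)) * ((e + d) + (d + c)))
    scaled-identity T hT = trans (left scaling toeplitz (+ 2 + M + K) T)
      (trans (cong₂ (λ x y → x * (+ 2 + M + K) * y) toeplitz-det hT)
      (trans (middle (1ℤ + M + K) (+ 2 + M + K) c)
      (trans (sym (cong₂ (λ x y → + 2 * (x * y)) product₀ (cong₂ _*_ product₁ product₂)))
      (right (1ℤ + M) (+ 2 + M) (1ℤ + K) (+ 2 + K) ((c + b) + (b + a)) ((d + c) + (c + b)) ((e + d) + (d + c))))))
      where
      left : ∀ q x r t → + 2 * q * (x * r * t) ≡ q * x * r * (+ 2 * t)
      left = solve-∀
      middle : ∀ r s c → + 2 * (r * r * s) * (c * c * c) * s * (s * r) ≡ + 2 * (r * s * c * ((r * s * c) * (r * s * c)))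
      middle = solve-∀
      right : ∀ m₁ m₂ k₁ k₂ x y z → + 2 * (m₂ * m₁ * x * ((m₁ * k₁ * y) * (k₂ * k₁ * z))) ≡
              + 2 * (m₁ * m₁ * m₂ * (k₁ * k₁ * k₂)) * (x * y * z)
      right = solve-∀

open DeterminantAlgebra
open import Defs
open import Data.Bool using (Bool; true; false; if_then_else_)
open import Data.Empty using (⊥-elim)
open import Data.Fin using (zero; suc)
open import Data.Integer as ℤ using (ℤ; 0ℤ; 1ℤ) renaming (+_ to pos)
import Data.Integer.Properties as ℤ
open import Data.Integer.Tactic.RingSolver using (solve-∀)
open import Data.List as List using (List; []; _∷_; _++_; length; replicate; map; concatMap; applyUpTo)
open import Data.List.Membership.Propositional using (_∈_; lose; find)
open import Data.List.Membership.Propositional.Properties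
open import Data.List.Properties using (length-replicate; length-map; length-++; map-++; map-upTo; ∷-injective)
open import Data.List.Relation.Unary.All as All using (All; []; _∷_)
open import Data.List.Relation.Unary.All.Properties using (replicate⁺)
open import Data.List.Relation.Unary.AllPairs using (AllPairs; []; _∷_; allPairs?)
open import Data.List.Relation.Unary.Any as Any using (here; there)
open import Data.List.Relation.Unary.Any.Properties using (lookup-index)
open import Data.List.Relation.Unary.Linked.Properties using (AllPairs⇒Linked; Linked⇒AllPairs)
open import Data.List.Relation.Unary.Unique.Propositional using (Unique)
import Data.List.Relation.Unary.Unique.Propositional.Properties as Unique
open import Data.Maybe using (just)
open import Data.Nat
open import Data.Nat.Combinatorics using (_C_; nCn≡1; nC1≡n; nCk≡nC[n∸k]; k>n⇒nCk≡0; nCk+nC[k+1]≡[n+1]C[k+1])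
open import Data.Nat.ListAction using (sum)
open import Data.Nat.ListAction.Properties using (sum-++)
open import Data.Nat.Properties
open import Data.Product hiding (map)
open import Data.Product.Properties using (≡-dec)
open import Data.Sum using (_⊎_; inj₁; inj₂)
open import Data.Vec using (Vec; []; _∷_)
open import Data.Vec.Membership.Propositional using () renaming (_∈_ to _∈ᵛ_; _∉_ to _∉ᵛ_)
open import Data.Vec.Relation.Unary.All as VAll using ([]; _∷_) renaming (All to VAll)
open import Data.Vec.Relation.Unary.AllPairs using ([]; _∷_) renaming (AllPairs to VPairs)
open import Data.Vec.Relation.Unary.Any using (here; there)
open import Function using (_∘_; id)
open import Relation.Binary.PropositionalEquality
open import Relation.Nullary using (¬_; Dec; does; ¬?)
open import Relation.Nullary.Decidable using (dec-true; dec-false; from-yes)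

-- Crossings of left and right arcs

opp : Side → Side
opp passL = passR
opp passR = passL

SideArc : Side → Arc → Set
SideArc s α = All (_≡ s) (sides α)

Sided : Arc → Set
Sided α = LeftArc α ⊎ RightArc α

side : ∀ {α} → Sided α → ∃ λ s → SideArc s α
side (inj₁ l) = passL , l
side (inj₂ r) = passR , r

sided : ∀ {α} s → SideArc s α → Sided α
sided passL = inj₁
sided passR = inj₂

-- The floor `q` on lower ends moves with the sweep; at `q` = 1 this is `WellFormedArc n`
-- definitionally.
ArcFrom : ℕ → ℕ → Arc → Set
ArcFrom n q α = (q ≤ lo α) × (lo α < hi α) × (hi α ≤ n)
              × (length (sides α) ≡ hi α ∸ lo α ∸ 1)

-- α neither crosses nor shares its upper end with an arc on side s from some point below lo α to h.
Free : Side → ℕ → Arc → Set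
Free s h α = (hi α ≢ h) × (SideArc s α → ¬ (lo α < h × h < hi α))

-- Meant for `lo α < lo β`. Quantifying over `s` lets an arc between consecutive points count on
-- both sides.
Compat : Arc → Arc → Set
Compat α β = ∀ s → SideArc s α → Free s (hi α) β

nth-All : ∀ {A : Set} {P : A → Set} {xs : List A} → All P xs → ∀ k → k < length xs →
          ∃ λ x → nth xs k ≡ just x × P x
nth-All (px ∷ pxs) zero    _       = _ , refl , px
nth-All (px ∷ pxs) (suc k) (s≤s k<) = nth-All pxs k k<

nth-All⁻ : ∀ {A : Set} {P : A → Set} {xs : List A} → All P xs → ∀ k {x} → nth xs k ≡ just x → P x
nth-All⁻ (px ∷ pxs) zero    refl = px
nth-All⁻ (px ∷ pxs) (suc k) eq   = nth-All⁻ pxs k eq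

posAt-inside : ∀ {n q α i} s → ArcFrom n q α → SideArc s α → lo α < i → i < hi α → PosAt α i (sidePos s)
posAt-inside {α = α} {i} s (_ , _ , _ , len) sa lo<i i<hi
  with nth-All sa (i ∸ suc (lo α)) (subst (i ∸ suc (lo α) <_)
         (trans (trans (cong (hi α ∸_) (+-comm 1 (lo α))) (sym (∸-+-assoc (hi α) (lo α) 1))) (sym len))
         (∸-monoˡ-< i<hi lo<i))
... | .s , eq , refl = between lo<i i<hi eq

posAt-cases : ∀ {α i x} s → SideArc s α → PosAt α i x →
              (x ≡ on × (i ≡ lo α ⊎ i ≡ hi α)) ⊎ (x ≡ sidePos s × lo α < i × i < hi α)
posAt-cases s sa atLo = inj₁ (refl , inj₁ refl)
posAt-cases s sa atHi = inj₁ (refl , inj₂ refl)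
posAt-cases {α} {i} s sa (between a b eq) = inj₂ (cong sidePos (nth-All⁻ sa (i ∸ suc (lo α)) eq) , a , b)

left≤ : ∀ {α i x} → LeftArc α → PosAt α i x → x ≢ right
left≤ l p refl with posAt-cases passL l p
... | inj₁ (() , _)
... | inj₂ (() , _)

right≥ : ∀ {α i x} → RightArc α → PosAt α i x → x ≢ left
right≥ r p refl with posAt-cases passR r p
... | inj₁ (() , _)
... | inj₂ (() , _)

-- A left arc only takes the positions `left` and `on`, a right arc only `on` and `right`. A
-- crossing needs both orders, so arcs on opposite sides never cross.
right≮left : ∀ {α β i} → RightArc α → LeftArc β → ¬ LeftAt α β i
right≮left r l (_ , _ , p , q , l<o) = right≥ r p refl
right≮left r l (_ , _ , p , q , l<r) = right≥ r p refl
right≮left r l (_ , _ , p , q , o<r) = left≤ l q refl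

-- Between left arcs the strict order can only be `left` before `on`, so an end of `β` lies strictly
-- inside the span of `α`.
left-cut : ∀ {α β i} → LeftArc α → LeftArc β → LeftAt α β i → lo α < i × i < hi α × (i ≡ lo β ⊎ i ≡ hi β)
left-cut a b (_ , _ , p , q , l<r) = ⊥-elim (left≤ b q refl)
left-cut a b (_ , _ , p , q , o<r) = ⊥-elim (left≤ b q refl)
left-cut a b (_ , _ , p , q , l<o) with posAt-cases passL a p | posAt-cases passL b q
... | inj₂ (_ , u , v) | inj₁ (_ , w) = u , v , w

right-cut : ∀ {α β i} → RightArc α → RightArc β → LeftAt α β i → lo β < i × i < hi β × (i ≡ lo α ⊎ i ≡ hi α)
right-cut a b (_ , _ , p , q , l<r) = ⊥-elim (right≥ a p refl)
right-cut a b (_ , _ , p , q , l<o) = ⊥-elim (right≥ a p refl)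
right-cut a b (_ , _ , p , q , o<r) with posAt-cases passR a p | posAt-cases passR b q
... | inj₁ (_ , w) | inj₂ (_ , u , v) = u , v , w

cut-at-top : ∀ (α β : Arc) {i} → lo α < lo β → lo β < i × i < hi β × (i ≡ lo α ⊎ i ≡ hi α) →
             lo β < hi α × hi α < hi β
cut-at-top _ _ lo< (u , v , inj₁ refl) = ⊥-elim (<-asym lo< u)
cut-at-top _ _ lo< (u , v , inj₂ refl) = u , v

-- A crossing on one side puts an end of `α` strictly inside the span of `β`. As `α` starts first,
-- this end is `hi α`, so the spans interleave, which `Compat` forbids.
compatible⇒¬crosses : ∀ {α β} → Sided α → Sided β → lo α < lo β → Compat α β → ¬ Crosses α β
compatible⇒¬crosses {α} {β} (inj₁ a) (inj₁ b) lo< c (i , j , p , q) =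
  proj₂ (c passL a) b (cut-at-top α β lo< (left-cut b a q))
compatible⇒¬crosses {α} {β} (inj₂ a) (inj₂ b) lo< c (i , j , p , q) =
  proj₂ (c passR a) b (cut-at-top α β lo< (right-cut a b p))
compatible⇒¬crosses (inj₁ a) (inj₂ b) lo< c (i , j , p , q) = right≮left b a q
compatible⇒¬crosses (inj₂ a) (inj₁ b) lo< c (i , j , p , q) = right≮left a b p

-- The two heights are `lo β`, where `α` passes the start of `β`, and `hi α`, where `β` passes the
-- end of `α`. Right arcs exchange their roles.
crosses : ∀ {n q α β} s → ArcFrom n q α → ArcFrom n q β → SideArc s α → SideArc s β →
          lo α < lo β → lo β < hi α → hi α < hi β → Crosses α β
crosses {α = α} {β} passL wα wβ a b x y z = lo β , hi α ,
  (left , on , posAt-inside passL wα a x y , atLo , l<o) ,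
  (left , on , posAt-inside passL wβ b y z , atHi , l<o)
crosses {α = α} {β} passR wα wβ a b x y z = hi α , lo β ,
  (on , right , atHi , posAt-inside passR wβ b y z , o<r) ,
  (on , right , atLo , posAt-inside passR wα a x y , o<r)

¬crosses⇒compatible : ∀ {n q α β} → ArcFrom n q α → ArcFrom n q β → lo α < lo β →
                      hi α ≢ hi β → ¬ Crosses α β → Compat α β
¬crosses⇒compatible wα wβ lo< hi≢ nc s a =
  (hi≢ ∘ sym) , λ b (x , y) → nc (crosses s wα wβ a b lo< x y)

-- Invariants of the sweep

-- xs lists the upper ends of the arcs on side s that have their lower end below and their upper end
-- above p, from the innermost to the outermost; D is the list of the arcs that start later.
record Pending (n p : ℕ) (s : Side) (D : List Arc) {i} (xs : Vec ℕ i) : Set where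
  constructor pending
  field
    range  : VAll (λ h → p < h × h ≤ n) xs
    sorted : VPairs _<_ xs
    free   : VAll (λ h → All (Free s h) D) xs
open Pending

record Arcs (n q : ℕ) (D : List Arc) : Set where
  constructor arcs
  field
    wf         : All (ArcFrom n q) D
    ordered    : AllPairs (λ α β → lo α < lo β) D
    onSide     : All Sided D
    compatible : AllPairs Compat D
open Arcs

-- The bound q on the lower ends of the arcs and the bound p on the upper ends of the pending ones
-- differ halfway through a step.
record Good (n q p : ℕ) (s : Side) {i j} (xs : Vec ℕ i) (ys : Vec ℕ j) (D : List Arc) : Set where
  constructor good
  field
    above : Arcs n q D
    own   : Pending n p s D xs
    other : Pending n p (opp s) D ys
    apart : ∀ {h} → h ∈ᵛ xs → h ∉ᵛ ys
open Good

opp-opp : ∀ s → opp (opp s) ≡ s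
opp-opp passL = refl
opp-opp passR = refl

private variable
  n p q i j : ℕ
  s : Side
  xs : Vec ℕ i
  ys : Vec ℕ j
  D : List Arc

mirror : Good n q p s xs ys D → Good n q p (opp s) ys xs D
mirror {s = s} g = good (above g) (other g)
  (subst (λ t → Pending _ _ t _ _) (sym (opp-opp s)) (own g)) (λ a b → apart g b a)

lower-cut : Pending n (suc p) s D xs → Pending n p s D xs
lower-cut (pending r so f) = pending (VAll.map (map₁ (<-trans (n<1+n _))) r) so f

lower-floor : Arcs n (suc q) D → Arcs n q D
lower-floor (arcs w o sd c) = arcs (All.map (map₁ <⇒≤) w) o sd c

lower-cuts : Good n q (suc p) s xs ys D → Good n q p s xs ys D
lower-cuts (good A P Q ap) = good A (lower-cut P) (lower-cut Q) ap

lower-base : Good n (suc q) p s xs ys D → Good n q p s xs ys D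
lower-base (good A P Q ap) = good (lower-floor A) P Q ap

free-below : ∀ {α} → ArcFrom n (suc p) α → ∀ t → Free t (suc p) α
free-below (a , b , _) t = (λ eq → <⇒≢ (≤-<-trans a b) (sym eq)) , λ _ (u , _) → <⇒≱ u a

-- All other pending ends exceed p + 1, so the new one is innermost; the later arcs start at p + 1
-- or above, so none of them can interleave with it or end there.
close : suc p ≤ n → Good n (suc p) (suc p) s xs ys D → Good n (suc p) p s (suc p ∷ xs) ys D
close p<n (good A (pending r so f) oth ap) = good A
  (pending ((n<1+n _ , p<n) ∷ range (lower-cut (pending r so f)))
           (VAll.map proj₁ r ∷ so)
           (All.map (λ w → free-below w _) (wf A) ∷ f))
  (lower-cut oth)
  λ { (here refl) h∈ → <-irrefl refl (proj₁ (VAll.lookup (range oth) h∈)) ; (there h∈) → ap h∈ }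

newArc : Side → ℕ → ℕ → Arc
newArc s p h = arc p h (replicate (h ∸ p ∸ 1) s)

replicate-other : ∀ {s t : Side} m → s ≢ t → All (_≡ t) (replicate m s) → m ≡ 0
replicate-other zero    _ _         = refl
replicate-other (suc m) s≢t (eq ∷ _) = ⊥-elim (s≢t eq)

-- Only an empty list of sides is constant for two different sides. Hence constraints from the
-- opposite side concern only arcs between consecutive points, where they hold trivially.
short-arc : ∀ {s t p h} → s ≢ t → SideArc t (newArc s p h) → h ≤ suc p
short-arc {p = p} {h} s≢t sa = subst (h ≤_) (+-comm p 1)
  (m∸n≡0⇒m≤n (trans (sym (∸-+-assoc h p 1)) (replicate-other (h ∸ p ∸ 1) s≢t sa)))

_≟ₛ_ : ∀ (s t : Side) → (s ≡ t) ⊎ (s ≢ t)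
passL ≟ₛ passL = inj₁ refl
passR ≟ₛ passR = inj₁ refl
passL ≟ₛ passR = inj₂ λ ()
passR ≟ₛ passL = inj₂ λ ()

s≢opp : ∀ s → s ≢ opp s
s≢opp passL ()
s≢opp passR ()

-- The innermost pending end `h` receives its start p. Compatibility with the later arcs is the
-- freeness recorded while `h` was pending, and the remaining ends on the same side lie beyond `h`,
-- so their arcs enclose the new one.
open-arc : ∀ {h} → Good n (suc p) p s (h ∷ xs) ys D → Good n p p s xs ys (newArc s p h ∷ D)
open-arc {n} {p} {s} {xs = xs} {D = D} {h = h}
         (good A (pending ((p<h , h≤n) ∷ r) (h< ∷ so) (fh ∷ f)) oth ap) = good
  (arcs ((≤-refl , p<h , h≤n , length-replicate (h ∸ p ∸ 1)) ∷ wf (lower-floor A))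
        (All.map proj₁ (wf A) ∷ ordered A)
        (sided {newArc s p h} s (replicate⁺ (h ∸ p ∸ 1) refl) ∷ onSide A)
        (All.zipWith (λ (w , fr) → new w fr) (wf A , fh) ∷ compatible A))
  (pending r so (VAll.map (λ (h<x , fx) → own-free h<x ∷ fx) (VAll.zip (h< , f))))
  (pending (range oth) (sorted oth) (other-free ap (range oth) (free oth)))
  (ap ∘ there)
  where
  new : ∀ {β} → ArcFrom n (suc p) β → Free s h β → Compat (newArc s p h) β
  new {β} w fr t sa with s ≟ₛ t
  ... | inj₁ refl = fr
  ... | inj₂ s≢t  = proj₁ fr , λ _ (u , _) → <⇒≱ (<-≤-trans u (short-arc s≢t sa)) (proj₁ w)
  own-free : ∀ {x} → h < x → Free s x (newArc s p h)
  own-free h<x = <⇒≢ h<x , λ _ (_ , v) → <-asym h<x v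
  other-free : ∀ {j} {ys : Vec ℕ j} → (∀ {x} → x ∈ᵛ (h ∷ xs) → x ∉ᵛ ys) →
               VAll (λ x → p < x × x ≤ n) ys → VAll (λ x → All (Free (opp s) x) D) ys →
               VAll (λ x → All (Free (opp s) x) (newArc s p h ∷ D)) ys
  other-free ap []       []       = []
  other-free ap ((p<x , _) ∷ r) (fx ∷ f) =
    (((λ eq → ap (here refl) (here eq)) ,
      λ sa (_ , v) → <⇒≱ (<-≤-trans v (short-arc (s≢opp s) sa)) p<x) ∷ fx)
    ∷ other-free (λ a b → ap a (there b)) r f

data Unclosed (n p : ℕ) (s : Side) (D : List Arc) : ∀ {i} → Vec ℕ i → Set where
  keep : Pending n (suc p) s D xs → Unclosed n p s D xs
  drop : Pending n (suc p) s D xs → Unclosed n p s D (suc p ∷ xs)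

-- Pending ends increase and exceed p, so only the head can be p + 1.
unclose : ∀ {i} {xs : Vec ℕ i} → Pending n p s D xs → Unclosed n p s D xs
unclose {xs = []} (pending [] [] []) = keep (pending [] [] [])
unclose {p = p} {xs = x ∷ xs} (pending ((p<x , x≤n) ∷ r) (x< ∷ so) (fx ∷ f)) with m≤n⇒m<n∨m≡n p<x
... | inj₁ sp<x = keep (pending ((sp<x , x≤n) ∷ raised) (x< ∷ so) (fx ∷ f))
  where raised = VAll.map (λ (x<y , _ , y≤n) → <-trans sp<x x<y , y≤n) (VAll.zip (x< , r))
... | inj₂ refl = drop (pending (VAll.map (λ (x<y , _ , y≤n) → x<y , y≤n) (VAll.zip (x< , r))) so f)

replicate-All : ∀ {s : Side} {ss} → All (_≡ s) ss → ss ≡ replicate (length ss) s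
replicate-All []          = refl
replicate-All (refl ∷ ps) = cong (_ ∷_) (replicate-All ps)

-- Inverse to `open-arc`. Freeness keeps each pending end on this side out of the span of `α` and
-- different from `hi α`; being above p, it lies beyond `hi α`, which therefore becomes the
-- innermost end.
unopen : ∀ {α} → lo α ≡ p → SideArc s α → Good n p p s xs ys (α ∷ D) →
         α ≡ newArc s p (hi α) × Good n (suc p) p s (hi α ∷ xs) ys D
unopen {p} {s} {n} {xs = xs} {ys = ys} {α = α} refl sa
       (good (arcs ((_ , lo<hi , hi≤n , len) ∷ w) (lo< ∷ ord) (_ ∷ sd) (cα ∷ cp)) (pending r so f) oth ap) =
  cong (arc _ _) (trans (replicate-All sa) (cong (λ l → replicate l s) len)) ,
  good (arcs (All.zipWith (λ (l , _ , w) → l , w) (lo< , w)) ord sd cp)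
       (pending ((lo<hi , hi≤n) ∷ r) (VAll.map head< (VAll.zip (r , f)) ∷ so)
                (All.map (λ c → c s sa) cα ∷ VAll.map All.tail f))
       (pending (range oth) (sorted oth) (VAll.map All.tail (free oth)))
       λ { (here refl) h∈ → proj₁ (All.head (VAll.lookup (free oth) h∈)) refl ; (there h∈) → ap h∈ }
  where
  head< : ∀ {x} → (p < x × x ≤ n) × All (Free s x) (α ∷ _) → hi α < x
  head< ((p<x , _) , (hi≢ , fr) ∷ _) = ≤∧≢⇒< (≮⇒≥ (λ x<hi → fr sa (p<x , x<hi))) hi≢

raise-floor : ∀ {α} → p < lo α → Arcs n p (α ∷ D) → Arcs n (suc p) (α ∷ D)
raise-floor p<lo (arcs ((_ , wα) ∷ w) (lo< ∷ ord) sd cp) =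
  arcs ((p<lo , wα) ∷ All.zipWith (λ (l , _ , w) → <-trans p<lo l , w) (lo< , w)) (lo< ∷ ord) sd cp

-- Enumeration of the states by steps

State : ℕ → ℕ → Set
State i j = Vec ℕ i × Vec ℕ j × List Arc

GoodState : ℕ → ℕ → ∀ {i j} → State i j → Set
GoodState n p (xs , ys , D) = Good n p p passL xs ys D

-- The events between p and p + 1: an arc may start at p and then an arc may end at p + 1. An arc from p
-- to p + 1 is both a left and a right arc; short covers it, so closeL never follows openL and closeR
-- never follows openR.
data Step : (i j i′ j′ : ℕ) → Set where
  skip short    : ∀ {i j} → Step i j i j
  openL         : ∀ {i j} → Step i j (suc i) j
  openR         : ∀ {i j} → Step i j i (suc j)
  closeL        : ∀ {i j} → Step (suc i) j i j
  closeR        : ∀ {i j} → Step i (suc j) i j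
  openL-closeR  : ∀ {i j} → Step i (suc j) (suc i) j
  openR-closeL  : ∀ {i j} → Step (suc i) j i (suc j)

endL : ∀ {i j} → ℕ → State i j → State (suc i) j
endL p (xs , ys , D) = suc p ∷ xs , ys , D

endR : ∀ {i j} → ℕ → State i j → State i (suc j)
endR p (xs , ys , D) = xs , suc p ∷ ys , D

startL : ∀ {i j} → ℕ → State (suc i) j → State i j
startL p (h ∷ xs , ys , D) = xs , ys , newArc passL p h ∷ D

startR : ∀ {i j} → ℕ → State i (suc j) → State i j
startR p (xs , h ∷ ys , D) = xs , ys , newArc passR p h ∷ D

-- Steps are carried out from the top down: p + 1 first becomes a pending end, then the innermost
-- pending end is given the start p.
apply : ∀ {i j i′ j′} → Step i j i′ j′ → ℕ → State i′ j′ → State i j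
apply skip         p = id
apply short        p = startL p ∘ endL p
apply openL        p = startL p
apply openR        p = startR p
apply closeL       p = endL p
apply closeR       p = endR p
apply openL-closeR p = startL p ∘ endR p
apply openR-closeL p = startR p ∘ endL p

Steps : ℕ → ℕ → Set
Steps i j = ∃₂ λ i′ j′ → Step i j i′ j′

downL : ∀ i j → List (Steps i j)
downL zero    j = []
downL (suc i) j = (_ , _ , closeL) ∷ (_ , _ , openR-closeL) ∷ []

downR : ∀ i j → List (Steps i j)
downR i zero    = []
downR i (suc j) = (_ , _ , closeR) ∷ (_ , _ , openL-closeR) ∷ []

steps : ∀ i j → List (Steps i j)
steps i j = (_ , _ , skip) ∷ (_ , _ , short) ∷ (_ , _ , openL) ∷ (_ , _ , openR) ∷ downL i j ++ downR i j

∈-steps : ∀ {i j i′ j′} (st : Step i j i′ j′) → (_ , _ , st) ∈ steps i j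
∈-steps skip         = here refl
∈-steps short        = there (here refl)
∈-steps openL        = there (there (here refl))
∈-steps openR        = there (there (there (here refl)))
∈-steps closeL       = there (there (there (there (here refl))))
∈-steps openR-closeL = there (there (there (there (there (here refl)))))
∈-steps (closeR {i} {j})       = there (there (there (there (∈-++⁺ʳ (downL i (suc j)) (here refl)))))
∈-steps (openL-closeR {i} {j}) = there (there (there (there (∈-++⁺ʳ (downL i (suc j)) (there (here refl))))))

-- The arcs of a state in enum p N i j live on the points up to p + N.
enum : ℕ → ℕ → ∀ i j → List (State i j)
expand : ∀ {i j} → ℕ → ℕ → Steps i j → List (State i j)
enum p zero    zero zero = ([] , [] , []) ∷ []
enum p zero    _    _    = []
enum p (suc N) i    j    = concatMap (expand p N) (steps i j)
expand p N (_ , _ , st) = map (apply st p) (enum (suc p) N _ _)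

private variable
  i′ j′ : ℕ

apply-good : suc p ≤ n → (st : Step i j i′ j′) (x : State i′ j′) →
             GoodState n (suc p) x → GoodState n p (apply st p x)
apply-good p< skip         x g = lower-base (lower-cuts g)
apply-good p< short        x g = open-arc (close p< g)
apply-good p< openL        (_ ∷ _ , _ , _) g = open-arc (lower-cuts g)
apply-good p< openR        (_ , _ ∷ _ , _) g = mirror (open-arc (mirror (lower-cuts g)))
apply-good p< closeL       x g = lower-base (close p< g)
apply-good p< closeR       x g = lower-base (mirror (close p< (mirror g)))
apply-good p< openL-closeR (_ ∷ _ , _ , _) g = open-arc (mirror (close p< (mirror g)))
apply-good p< openR-closeL (_ , _ ∷ _ , _) g = mirror (open-arc (mirror (close p< g)))

Applied : ∀ {i j} → ℕ → ℕ → State i j → Set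
Applied {i} {j} n p x = ∃₂ λ i′ j′ → Σ (Step i j i′ j′) λ st → Σ (State i′ j′) λ y →
                        GoodState n (suc p) y × x ≡ apply st p y

data Closing (n p : ℕ) : ∀ {i j} → State i j → Set where
  none  : ∀ {i j} {y : State i j} → GoodState n (suc p) y → Closing n p y
  left  : ∀ {i j} {y : State i j} → GoodState n (suc p) y → Closing n p (endL p y)
  right : ∀ {i j} {y : State i j} → GoodState n (suc p) y → Closing n p (endR p y)

closing : (x : State i j) → Good n (suc p) p passL (proj₁ x) (proj₁ (proj₂ x)) (proj₂ (proj₂ x)) →
          Closing n p x
closing (xs , ys , D) (good A P Q ap) with unclose P | unclose Q
... | keep P′ | keep Q′ = none  (good A P′ Q′ ap)
... | drop P′ | keep Q′ = left  (good A P′ Q′ (ap ∘ there))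
... | keep P′ | drop Q′ = right (good A P′ Q′ (λ a → ap a ∘ there))
-- A left and a right arc cannot both end at p + 1.
... | drop P′ | drop Q′ = ⊥-elim (ap (here refl) (here refl))

-- The step is read off in two decisions: whether the first arc of the sorted list starts at p, and
-- on which side; then whether an arc ends at p + 1.
unapply : (x : State i j) → GoodState n p x → Applied n p x
unapply {n = n} {p = p} (xs , ys , D) g = opening D g
  where
  unopened : ∀ {i j} (x : State i j) → Closing n p x → Applied n p x
  unopened _ (none  h) = _ , _ , skip   , _ , h , refl
  unopened _ (left  h) = _ , _ , closeL , _ , h , refl
  unopened _ (right h) = _ , _ , closeR , _ , h , refl
  openedL : ∀ {i j} (x : State (suc i) j) → Closing n p x → Applied n p (startL p x)
  openedL (_ ∷ _ , _ , _) (none  h) = _ , _ , openL , _ , h , refl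
  openedL (_ ∷ _ , _ , _) (left  h) = _ , _ , short , _ , h , refl
  openedL (_ ∷ _ , _ , _) (right h) = _ , _ , openL-closeR , _ , h , refl
  openedR : ∀ {i j} (x : State i (suc j)) → Closing n p x → Applied n p (startR p x)
  openedR (_ , _ ∷ _ , _) (none  h) = _ , _ , openR , _ , h , refl
  openedR (_ , _ ∷ _ , _) (left  h) = _ , _ , openR-closeL , _ , h , refl
  -- An arc from p to p + 1 that was classified as a right arc has no sides, so it is the arc that
  -- `short` builds as a left one.
  openedR (_ , _ ∷ _ , _) (right {y = y} h) = _ , _ , short , y , h ,
    cong (λ ss → proj₁ y , proj₁ (proj₂ y) , arc p (suc p) ss ∷ proj₂ (proj₂ y)) no-sides
    where
    no-sides : replicate (suc p ∸ p ∸ 1) passR ≡ replicate (suc p ∸ p ∸ 1) passL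
    no-sides rewrite m+n∸n≡m 1 p = refl
  opening : ∀ {i j} {xs : Vec ℕ i} {ys : Vec ℕ j} D → Good n p p passL xs ys D → Applied n p (xs , ys , D)
  opening []      (good _ P Q ap) = unopened _ (closing _ (good (arcs [] [] [] []) P Q ap))
  opening (α ∷ D) g with m≤n⇒m<n∨m≡n (proj₁ (All.head (Arcs.wf (Good.above g))))
  ... | inj₁ p<lo = unopened _ (closing _ (record { above = raise-floor p<lo (Good.above g)
                                                  ; own = Good.own g ; other = Good.other g ; apart = Good.apart g }))
  ... | inj₂ p≡lo with All.head (Arcs.onSide (Good.above g))
  ...   | inj₁ l with unopen (sym p≡lo) l g
  ...     | eq , h = subst (λ β → Applied n p (_ , _ , β ∷ D)) (sym eq) (openedL (_ ∷ _ , _ , D) (closing _ h))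
  opening (α ∷ D) g | inj₂ p≡lo | inj₂ r with unopen (sym p≡lo) r (mirror g)
  ...     | eq , h = subst (λ β → Applied n p (_ , _ , β ∷ D)) (sym eq) (openedR (_ , _ ∷ _ , D) (closing _ (mirror h)))

enum-sound : ∀ N {p i j} → p + N ≡ n → (x : State i j) → x ∈ enum p N i j → GoodState n p x
enum-sound zero {i = zero} {zero} eq _ (here refl) =
  good (arcs [] [] [] []) (pending [] [] []) (pending [] [] []) λ ()
enum-sound {n} (suc N) {p} {i} {j} eq x x∈ with find (∈-concatMap⁻ (expand p N) {xs = steps i j} x∈)
... | (_ , _ , st) , _ , x∈′ with ∈-map⁻ (apply st p) x∈′
...   | y , y∈ , refl = apply-good (m+n≤o⇒m≤o (suc p) (≤-reflexive eq′)) st y (enum-sound N eq′ y y∈)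
  where eq′ = trans (sym (+-suc p N)) eq

enum-complete : ∀ N {p i j} → p + N ≡ n → (x : State i j) → GoodState n p x → x ∈ enum p N i j
enum-complete {n} zero {p} eq x g with refl ← trans (sym (+-identityʳ p)) eq = at-end x g
  where
  at-end : ∀ {i j} (x : State i j) → GoodState n n x → x ∈ enum n zero i j
  at-end ([] , [] , []) g = here refl
  at-end (_ ∷ _ , _ , _) g with VAll.head (Pending.range (Good.own g))
  ... | a , b = ⊥-elim (<⇒≱ a b)
  at-end ([] , _ ∷ _ , _) g with VAll.head (Pending.range (Good.other g))
  ... | a , b = ⊥-elim (<⇒≱ a b)
  at-end ([] , [] , _ ∷ _) g with All.head (Arcs.wf (Good.above g))
  ... | a , b , c , _ = ⊥-elim (<⇒≱ (≤-<-trans a b) c)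
enum-complete (suc N) {p} eq x g with unapply x g
... | _ , _ , st , y , h , refl = ∈-concatMap⁺ (expand p N) (lose (∈-steps st)
  (∈-map⁺ (apply st p) (enum-complete N (trans (sym (+-suc p N)) eq) y h)))

-- Distinctness of the enumerated states

kindOf : List Side → ℕ
kindOf []          = 1
kindOf (passL ∷ _) = 2
kindOf (passR ∷ _) = 3

openKind : ℕ → List Arc → ℕ
openKind p []      = 0
openKind p (α ∷ D) = if does (lo α ≟ p) then kindOf (sides α) else 0

startsAt : ∀ {i} → ℕ → Vec ℕ i → ℕ
startsAt p []      = 0
startsAt p (x ∷ _) = if does (x ≟ p) then 1 else 0

-- Decides which step a state was built with; this separates the images of the steps.
kind : ∀ {i j} → ℕ → State i j → ℕ × ℕ × ℕ
kind p (xs , ys , D) = openKind p D , startsAt (suc p) xs , startsAt (suc p) ys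

code : ∀ {i j i′ j′} → Step i j i′ j′ → ℕ × ℕ × ℕ
code skip         = 0 , 0 , 0
code short        = 1 , 0 , 0
code openL        = 2 , 0 , 0
code openR        = 3 , 0 , 0
code closeL       = 0 , 1 , 0
code closeR       = 0 , 0 , 1
code openL-closeR = 2 , 0 , 1
code openR-closeL = 3 , 1 , 0

openKind-none : ∀ {q D} → p < q → Arcs n q D → openKind p D ≡ 0
openKind-none {D = []} _ _ = refl
openKind-none {p = p} {D = α ∷ _} p<q A
  rewrite dec-false (lo α ≟ p) (λ eq → <⇒≢ (<-≤-trans p<q (proj₁ (All.head (Arcs.wf A)))) (sym eq)) = refl

openKind-new : ∀ p s h D → openKind p (newArc s p h ∷ D) ≡ kindOf (replicate (h ∸ p ∸ 1) s)
openKind-new p s h D rewrite dec-true (p ≟ p) refl = refl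

-- An end beyond p + 1 leaves at least one point to pass, so the side can be read off the arc.
openKind-long : ∀ s D {h} → suc p < h → openKind p (newArc s p h ∷ D) ≡ kindOf (s ∷ [])
openKind-long {p} s D {h} p<h = trans (openKind-new p s h D) (nonempty s (h ∸ p ∸ 1) positive)
  where
  positive : 0 < h ∸ p ∸ 1
  positive = subst (0 <_) (trans (cong (h ∸_) (+-comm 1 p)) (sym (∸-+-assoc h p 1))) (m<n⇒0<n∸m p<h)
  nonempty : ∀ s m → 0 < m → kindOf (replicate m s) ≡ kindOf (s ∷ [])
  nonempty passL (suc m) _ = refl
  nonempty passR (suc m) _ = refl

openKind-short : ∀ p s D → openKind p (newArc s p (suc p) ∷ D) ≡ 1
openKind-short p s D rewrite openKind-new p s (suc p) D | m+n∸n≡m 1 p = refl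

startsAt-none : ∀ {s D} {xs : Vec ℕ i} → Pending n p s D xs → startsAt p xs ≡ 0
startsAt-none {xs = []} _ = refl
startsAt-none {p = p} {xs = x ∷ _} P
  rewrite dec-false (x ≟ p) (λ eq → <⇒≢ (proj₁ (VAll.head (Pending.range P))) (sym eq)) = refl

startsAt-head : ∀ p {xs : Vec ℕ i} → startsAt p (p ∷ xs) ≡ 1
startsAt-head p rewrite dec-true (p ≟ p) refl = refl

private
  triple : ∀ {a b c a′ b′ c′ : ℕ} → a ≡ a′ → b ≡ b′ → c ≡ c′ → (a , b , c) ≡ (a′ , b′ , c′)
  triple refl refl refl = refl

  pending-tail : ∀ {s D h} {xs : Vec ℕ i} → Pending n p s D (h ∷ xs) → Pending n p s D xs
  pending-tail (pending (_ ∷ r) (_ ∷ so) (_ ∷ f)) = pending r so f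

-- In a state that is good above p + 1 no arc starts at p and no pending end is p + 1, so `kind`
-- sees exactly what the step has added.
kind-apply : (st : Step i j i′ j′) (y : State i′ j′) → GoodState n (suc p) y → kind p (apply st p y) ≡ code st
kind-apply skip  y (good A P Q _) = triple (openKind-none (n<1+n _) A) (startsAt-none P) (startsAt-none Q)
kind-apply {p = p} short (_ , _ , D) (good A P Q _) = triple (openKind-short p passL D) (startsAt-none P) (startsAt-none Q)
kind-apply openL (_ ∷ _ , _ , D) (good A P Q _) =
  triple (openKind-long passL D (proj₁ (VAll.head (Pending.range P)))) (startsAt-none (pending-tail P)) (startsAt-none Q)
kind-apply openR (_ , _ ∷ _ , D) (good A P Q _) =
  triple (openKind-long passR D (proj₁ (VAll.head (Pending.range Q)))) (startsAt-none P) (startsAt-none (pending-tail Q))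
kind-apply {p = p} closeL y (good A P Q _) =
  triple (openKind-none (n<1+n _) A) (startsAt-head (suc p) {proj₁ y}) (startsAt-none Q)
kind-apply {p = p} closeR y (good A P Q _) =
  triple (openKind-none (n<1+n _) A) (startsAt-none P) (startsAt-head (suc p) {proj₁ (proj₂ y)})
kind-apply {p = p} openL-closeR (_ ∷ _ , ys , D) (good A P Q _) =
  triple (openKind-long passL D (proj₁ (VAll.head (Pending.range P))))
         (startsAt-none (pending-tail P)) (startsAt-head (suc p) {ys})
kind-apply {p = p} openR-closeL (xs , _ ∷ _ , D) (good A P Q _) =
  triple (openKind-long passR D (proj₁ (VAll.head (Pending.range Q))))
         (startsAt-head (suc p) {xs}) (startsAt-none (pending-tail Q))

endL-injective : ∀ {x y : State i j} → endL p x ≡ endL p y → x ≡ y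
endL-injective refl = refl

endR-injective : ∀ {x y : State i j} → endR p x ≡ endR p y → x ≡ y
endR-injective refl = refl

startL-injective : ∀ {x y : State (suc i) j} → startL p x ≡ startL p y → x ≡ y
startL-injective {x = x ∷ _ , _ , _} {y ∷ _ , _ , _} eq
  with cong proj₁ eq | cong (proj₁ ∘ proj₂) eq | cong (proj₂ ∘ proj₂) eq
... | refl | refl | eq′ with ∷-injective eq′
...   | eq″ , refl with cong hi eq″
...     | refl = refl

startR-injective : ∀ {x y : State i (suc j)} → startR p x ≡ startR p y → x ≡ y
startR-injective {x = _ , x ∷ _ , _} {_ , y ∷ _ , _} eq
  with cong proj₁ eq | cong (proj₁ ∘ proj₂) eq | cong (proj₂ ∘ proj₂) eq
... | refl | refl | eq′ with ∷-injective eq′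
...   | eq″ , refl with cong hi eq″
...     | refl = refl

apply-injective : (st : Step i j i′ j′) → ∀ {x y} → apply st p x ≡ apply st p y → x ≡ y
apply-injective skip         = id
apply-injective short        = endL-injective ∘ startL-injective
apply-injective openL        = startL-injective
apply-injective openR        = startR-injective
apply-injective closeL       = endL-injective
apply-injective closeR       = endR-injective
apply-injective openL-closeR = endR-injective ∘ startL-injective
apply-injective openR-closeL = endL-injective ∘ startR-injective

stepCode : Steps i j → ℕ × ℕ × ℕ
stepCode (_ , _ , st) = code st

distinct? : ∀ i j → Dec (AllPairs (λ s t → stepCode s ≢ stepCode t) (steps i j))
distinct? i j = allPairs? (λ s t → ¬? (≡-dec _≟_ (≡-dec _≟_ _≟_) (stepCode s) (stepCode t))) (steps i j)

-- The list of steps is closed once it is known whether `i` and `j` vanish; a decision procedure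
-- does the rest.
codes-distinct : ∀ i j → AllPairs (λ s t → stepCode s ≢ stepCode t) (steps i j)
codes-distinct zero    zero    = from-yes (distinct? zero zero)
codes-distinct (suc i) zero    = from-yes (distinct? (suc i) zero)
codes-distinct zero    (suc j) = from-yes (distinct? zero (suc j))
codes-distinct (suc i) (suc j) = from-yes (distinct? (suc i) (suc j))

unique-concatMap : ∀ {A B K : Set} (key : B → K) (label : A → K) (f : A → List B) →
                   ∀ {as} → AllPairs (λ a b → label a ≢ label b) as → All (Unique ∘ f) as →
                   (∀ a {b} → b ∈ f a → key b ≡ label a) → Unique (concatMap f as)
unique-concatMap key label f []          []       labels = []
unique-concatMap key label f {as = a ∷ as} (a≢ ∷ ds) (u ∷ us) labels =
  Unique.++⁺ u (unique-concatMap key label f ds us labels) disjoint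
  where
  disjoint : ∀ {b} → ¬ (b ∈ f a × b ∈ concatMap f as)
  disjoint (b∈a , b∈) with find (∈-concatMap⁻ f {xs = as} b∈)
  ... | c , c∈ , b∈c = All.lookup a≢ c∈ (trans (sym (labels a b∈a)) (labels c b∈c))

enum-unique : ∀ N {p i j} → p + N ≡ n → Unique (enum p N i j)
enum-unique zero {i = zero} {zero} eq = [] ∷ []
enum-unique zero {i = zero} {suc _} eq = []
enum-unique zero {i = suc _} eq = []
enum-unique (suc N) {p} {i} {j} eq = unique-concatMap (kind p) stepCode (expand p N) (codes-distinct i j)
  (All.universal (λ (_ , _ , st) → Unique.map⁺ (apply-injective st) (enum-unique N eq′)) (steps i j))
  labels
  where
  eq′ = trans (sym (+-suc p N)) eq
  labels : ∀ s {b} → b ∈ expand p N s → kind p b ≡ stepCode s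
  labels (_ , _ , st) b∈ with ∈-map⁻ (apply st p) b∈
  ... | y , y∈ , refl = kind-apply st y (enum-sound N eq′ y y∈)

-- Diagrams as states with nothing pending

diagram⇒good : ∀ {D} → LeftRightDiagram n D → GoodState n 1 ([] , [] , D)
diagram⇒good {n} {D} ((wf , linked , hi≢ , nc) , sd) = good (arcs wf increasing sd (compats wf increasing hi≢ nc))
  (pending [] [] []) (pending [] [] []) λ ()
  where
  increasing : AllPairs (λ α β → lo α < lo β) D
  increasing = Linked⇒AllPairs <-trans linked
  compats : ∀ {D} → All (ArcFrom n 1) D → AllPairs (λ α β → lo α < lo β) D → AllPairs (λ α β → hi α ≢ hi β) D →
            AllPairs (λ α β → ¬ Crosses α β) D → AllPairs Compat D
  compats []       []       []       []       = []
  compats (w ∷ ws) (l ∷ ls) (h ∷ hs) (c ∷ cs) =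
    All.zipWith (λ ((w′ , l′) , (h′ , c′)) → ¬crosses⇒compatible w w′ l′ h′ c′) (All.zip (ws , l) , All.zip (h , c))
    ∷ compats ws ls hs cs

good⇒diagram : ∀ {D} → GoodState n 1 ([] , [] , D) → LeftRightDiagram n D
good⇒diagram {n} {D} (good (arcs wf ordered sd cp) _ _ _) =
  (wf , AllPairs⇒Linked ordered , his sd cp , ncs sd ordered cp) , sd
  where
  his : ∀ {D} → All Sided D → AllPairs Compat D → AllPairs (λ α β → hi α ≢ hi β) D
  his []       []       = []
  his {α ∷ _} (s ∷ ss) (c ∷ cs) = All.map (λ c′ → proj₁ (c′ _ (proj₂ (side {α} s))) ∘ sym) c ∷ his ss cs
  ncs : ∀ {D} → All Sided D → AllPairs (λ α β → lo α < lo β) D → AllPairs Compat D →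
        AllPairs (λ α β → ¬ Crosses α β) D
  ncs []       []       []       = []
  ncs (s ∷ ss) (l ∷ ls) (c ∷ cs) =
    All.zipWith (λ ((s′ , l′) , c′) → compatible⇒¬crosses s s′ l′ c′) (All.zip (ss , l) , c) ∷ ncs ss ls cs

lookup-injective : ∀ {A : Set} {xs : List A} → Unique xs → ∀ i j → List.lookup xs i ≡ List.lookup xs j → i ≡ j
lookup-injective (x≢ ∷ u) zero    zero    eq = refl
lookup-injective (x≢ ∷ u) zero    (suc j) eq = ⊥-elim (All.lookup x≢ (∈-lookup j) eq)
lookup-injective (x≢ ∷ u) (suc i) zero    eq = ⊥-elim (All.lookup x≢ (∈-lookup i) (sym eq))
lookup-injective (x≢ ∷ u) (suc i) (suc j) eq = cong suc (lookup-injective u i j eq)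

list-cardinality : ∀ {A : Set} {P : A → Set} (xs : List A) → Unique xs →
                   (∀ x → x ∈ xs → P x) → (∀ x → P x → x ∈ xs) → HasCardinality P (length xs)
list-cardinality xs unique sound complete =
  List.lookup xs , (λ i j → lookup-injective unique i j) , (λ i → sound _ (∈-lookup i)) ,
  λ x px → Any.index (complete x px) , sym (lookup-index (complete x px))

arcsOf : State 0 0 → List Arc
arcsOf (_ , _ , D) = D

arcsOf-injective : ∀ {x y} → arcsOf x ≡ arcsOf y → x ≡ y
arcsOf-injective {[] , [] , _} {[] , [] , _} refl = refl

diagrams-cardinality : ∀ N → HasCardinality (LeftRightDiagram (suc N)) (length (enum 1 N 0 0))
diagrams-cardinality N = subst (HasCardinality _) (length-map arcsOf states)
  (list-cardinality (map arcsOf states) (Unique.map⁺ arcsOf-injective (enum-unique N refl)) sound complete)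
  where
  states : List (State 0 0)
  states = enum 1 N 0 0
  sound : ∀ D → D ∈ map arcsOf states → LeftRightDiagram (suc N) D
  sound D D∈ with ∈-map⁻ arcsOf D∈
  ... | ([] , [] , _) , x∈ , refl = good⇒diagram (enum-sound N refl _ x∈)
  complete : ∀ D → LeftRightDiagram (suc N) D → D ∈ map arcsOf states
  complete D d = ∈-map⁺ arcsOf (enum-complete N refl ([] , [] , D) (diagram⇒good d))

-- Refined counting of walks

-- Whether the walk, read as three vicious walkers, moves the last walker.
raises : ∀ {i j i′ j′} → Step i j i′ j′ → Bool
raises skip         = false
raises short        = true
raises openL        = true
raises openR        = true
raises closeL       = false
raises closeR       = false
raises openL-closeR = false
raises openR-closeL = true

-- Multiplication of the generating function of `f` by its variable, if the last walker moves.
shift : Bool → (ℕ → ℕ) → ℕ → ℕ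
shift false f k       = f k
shift true  f zero    = 0
shift true  f (suc k) = f k

-- The walks of N steps from (i , j) to (0 , 0) in which the last walker moves k times.
walks : ℕ → ℕ → ℕ → ℕ → ℕ
walksVia : ∀ {i j} → ℕ → ℕ → Steps i j → ℕ
walks zero    zero zero zero = 1
walks zero    _    _    _    = 0
walks (suc N) i    j    k    = sum (map (walksVia N k) (steps i j))
walksVia N k (i , j , st) = shift (raises st) (walks N i j) k

Σ< : ℕ → (ℕ → ℕ) → ℕ
Σ< n f = sum (applyUpTo f n)

Σ<-zero : ∀ n {f} → (∀ k → f k ≡ 0) → Σ< n f ≡ 0
Σ<-zero zero    f≡0 = refl
Σ<-zero (suc n) f≡0 = cong₂ _+_ (f≡0 0) (Σ<-zero n (f≡0 ∘ suc))

Σ<-+ : ∀ n f g → Σ< n (λ k → f k + g k) ≡ Σ< n f + Σ< n g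
Σ<-+ zero    f g = refl
Σ<-+ (suc n) f g rewrite Σ<-+ n (f ∘ suc) (g ∘ suc) = interchange (f 0) (g 0) _ _
  where open import Algebra.Properties.CommutativeSemigroup +-commutativeSemigroup using (interchange)

Σ<-sum : ∀ {A : Set} n (g : ℕ → A → ℕ) as →
         Σ< n (λ k → sum (map (g k) as)) ≡ sum (map (λ a → Σ< n (λ k → g k a)) as)
Σ<-sum n g []       = Σ<-zero n (λ _ → refl)
Σ<-sum n g (a ∷ as) = trans (Σ<-+ n (λ k → g k a) _) (cong (Σ< n (λ k → g k a) +_) (Σ<-sum n g as))

length-concatMap : ∀ {A B : Set} (f : A → List B) (h : A → ℕ) → (∀ a → length (f a) ≡ h a) →
                   ∀ as → length (concatMap f as) ≡ sum (map h as)
length-concatMap f h eq []       = refl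
length-concatMap f h eq (a ∷ as) = trans (length-++ (f a)) (cong₂ _+_ (eq a) (length-concatMap f h eq as))

-- In N steps the last walker moves at most N times, so any M > N catches all walks. Leaving M free
-- absorbs the index shift of the steps that move it.
length-enum : ∀ N {p i j} M → N < M → length (enum p N i j) ≡ Σ< M (walks N i j)
length-enum zero {i = zero}  {zero}  (suc M) _ = cong suc (sym (Σ<-zero M (λ _ → refl)))
length-enum zero {i = zero}  {suc _} M       _ = sym (Σ<-zero M (λ _ → refl))
length-enum zero {i = suc _}         M       _ = sym (Σ<-zero M (λ _ → refl))
length-enum (suc N) {p} {i} {j} (suc M) (s≤s N<M) = trans
  (length-concatMap (expand p N) (λ s → Σ< (suc M) (λ k → walksVia N k s)) via (steps i j))
  (sym (Σ<-sum (suc M) (walksVia N) (steps i j)))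
  where
  via : ∀ s → length (expand p N s) ≡ Σ< (suc M) (λ k → walksVia N k s)
  via (_ , _ , st) = trans (length-map (apply st p) (enum (suc p) N _ _)) shifted
    where
    shifted : length (enum (suc p) N _ _) ≡ Σ< (suc M) (shift (raises st) (walks N _ _))
    shifted with raises st
    ... | false = length-enum N (suc M) (m<n⇒m<1+n N<M)
    ... | true  = length-enum N M N<M

-- Vicious walkers and the binomial determinant

nC0≡1 : ∀ n → n C 0 ≡ 1
nC0≡1 n = trans (nCk≡nC[n∸k] {0} {n} z≤n) (nCn≡1 n)

-- binom N x t is the binomial coefficient N over x - t, which is 0 when x < t.
binom : ℕ → ℕ → Row
binom N x       zero    = pos (N C x)
binom N zero    (suc t) = 0ℤ
binom N (suc x) (suc t) = binom N x t

next : Row → Row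
next r t = r (suc t)

pascal : ∀ N x t → binom (suc N) x t ≡ binom N x t ℤ.+ next (binom N x) t
pascal N zero    zero    = cong pos (trans (nC0≡1 (suc N)) (sym (trans (+-identityʳ _) (nC0≡1 N))))
pascal N (suc x) zero    = cong pos (trans (sym (nCk+nC[k+1]≡[n+1]C[k+1] N x)) (+-comm (N C x) _))
pascal N zero    (suc t) = refl
pascal N (suc x) (suc t) = pascal N x t

-- The Lindström-Gessel-Viennot determinant: one row for each walker, one column for each target 0,
-- 1, 2. `binom N x t` counts the ways from x to t in N steps that stay or go down by one.
binom-det : ℕ → ℕ → ℕ → ℕ → ℤ
binom-det N z y x = det (binom N z) (binom N y) (binom N x)

binom-0-big : ∀ t x → t < x → binom 0 x t ≡ 0ℤ
binom-0-big zero    x       t<x       = cong pos (k>n⇒nCk≡0 t<x)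
binom-0-big (suc t) (suc x) (s≤s t<x) = binom-0-big t x t<x

-- Without steps a walker beyond 2 reaches no target, so its row vanishes. In `walks-det` this
-- settles every start other than 0, 1, 2.
binom-det-0 : ∀ z y x → 2 < x → binom-det 0 z y x ≡ 0ℤ
binom-det-0 z y x 2<x = det-zero₃ (binom 0 z) (binom 0 y) (binom 0 x)
  (binom-0-big 0 x (<-trans (s≤s z≤n) 2<x)) (binom-0-big 1 x (<-trans (s≤s (s≤s z≤n)) 2<x)) (binom-0-big 2 x 2<x)

-- The last walker cannot go below 0: the row `next (binom N 0)` is zero, in agreement with `shift`
-- at k = 0.
raised : ∀ N k i j v w → (∀ k′ → k ≡ suc k′ → pos (walks N i j k′) ≡ det (next (binom N k)) v w) →
         pos (shift true (walks N i j) k) ≡ det (next (binom N k)) v w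
raised N zero    i j v w ih = sym (det-zero₁ (next (binom N 0)) v w refl refl refl)
raised N (suc k) i j v w ih = ih k refl

sum-steps : ∀ i j (f : Steps i j → ℕ) → sum (map f (steps i j)) ≡
  f (_ , _ , skip) + (f (_ , _ , short) + (f (_ , _ , openL) + (f (_ , _ , openR) +
    (sum (map f (downL i j)) + sum (map f (downR i j))))))
sum-steps i j f = cong (λ m → f (_ , _ , skip) + (f (_ , _ , short) + (f (_ , _ , openL) + (f (_ , _ , openR) + m))))
  (trans (cong sum (map-++ f (downL i j) (downR i j))) (sum-++ (map f (downL i j)) _))

-- The walkers are at k < y < x. By Pascal's rule the determinant splits along the eight moves of the
-- three walkers; a move that makes two walkers collide has two equal rows, so it contributes 0 just as
-- the forbidden steps do.
walks-det : ∀ N {i j k y x} → y ≡ suc (j + k) → x ≡ suc (i + y) → pos (walks N i j k) ≡ binom-det N k y x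
downL-det : ∀ N i j k → let u = binom N k; v = binom N (suc (j + k)); w = binom N (suc (i + suc (j + k))) in
  pos (sum (map (walksVia N k) (downL i j))) ≡ det u v (next w) ℤ.+ det (next u) v (next w)
downR-det : ∀ N i j k → let u = binom N k; v = binom N (suc (j + k)); w = binom N (suc (i + suc (j + k))) in
  pos (sum (map (walksVia N k) (downR i j))) ≡ det u (next v) (next w) ℤ.+ det u (next v) w

walks-det zero {zero} {zero} {zero} refl refl = refl
walks-det zero {zero} {zero} {suc k} refl refl =
  sym (binom-det-0 (suc k) (suc (suc k)) (suc (suc (suc k))) (s≤s (s≤s (s≤s z≤n))))
walks-det zero {zero} {suc j} {k} refl refl =
  sym (binom-det-0 k (suc (suc (j + k))) (suc (suc (suc (j + k)))) (s≤s (s≤s (s≤s z≤n))))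
walks-det zero {suc i} {j} {k} refl refl =
  sym (binom-det-0 k (suc (j + k)) (suc (suc (i + suc (j + k)))) (s≤s (s≤s (≤-trans (s≤s z≤n) (m≤n+m _ i)))))
walks-det (suc N) {i} {j} {k} refl refl = trans
  (trans (cong pos (sum-steps i j (walksVia N k)))
    (cong₂ ℤ._+_ (walks-det N refl refl)
    -- `next` turns the row of a positive position into the row one below; the equations passed to
    -- `walks-det` adjust the gaps accordingly.
    (cong₂ ℤ._+_ (raised N k i j (next v) (next w) λ { k′ refl → walks-det N (+-suc j k′) (+-suc i _) })
    (cong₂ ℤ._+_ (raised N k (suc i) j (next v) w λ { k′ refl → walks-det N (+-suc j k′) (cong suc (+-suc i _)) })
    (cong₂ ℤ._+_ (raised N k i (suc j) v w λ { k′ refl → walks-det N (cong suc (+-suc j k′)) refl })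
    (cong₂ ℤ._+_ (downL-det N i j k) (downR-det N i j k)))))))
  (sym (det-additive u (next u) v (next v) w (next w)
    (pascal N k) (pascal N (suc (j + k))) (pascal N (suc (i + suc (j + k))))))
  where
  u = binom N k
  v = binom N (suc (j + k))
  w = binom N (suc (i + suc (j + k)))
downL-det N zero    j k = sym (cong₂ ℤ._+_ (det-equal₂₃ (binom N k) (binom N (suc (j + k))))
                                           (det-equal₂₃ (next (binom N k)) (binom N (suc (j + k)))))
downL-det N (suc i) j k = cong₂ ℤ._+_ (walks-det N refl refl) (trans (cong pos (+-identityʳ _))
  (raised N k i (suc j) (binom N (suc (j + k))) (binom N (suc (i + suc (j + k))))
    λ { k′ refl → walks-det N (cong suc (+-suc j k′)) refl }))
downR-det N i zero    k = sym (cong₂ ℤ._+_ (det-equal₁₂ (binom N k) (binom N (i + suc k)))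
                                           (det-equal₁₂ (binom N k) (binom N (suc (i + suc k)))))
downR-det N i (suc j) k = cong₂ ℤ._+_ (walks-det N refl (+-suc i _))
  (trans (cong pos (+-identityʳ _)) (walks-det N refl (cong suc (+-suc i _))))

-- Evaluation of the determinant

absorb : ∀ n k → suc k * (suc n C suc k) ≡ suc n * (n C k)
absorb zero    zero    = refl
absorb zero    (suc k) = trans (cong (suc (suc k) *_) (k>n⇒nCk≡0 {1} {suc (suc k)} (s≤s (s≤s z≤n))))
  (trans (*-zeroʳ (suc (suc k))) (sym (trans (*-identityˡ _) (k>n⇒nCk≡0 {0} {suc k} (s≤s z≤n)))))
absorb (suc n) zero    = trans (*-identityˡ _) (trans (nC1≡n (suc (suc n)))
  (sym (trans (cong (suc (suc n) *_) (nC0≡1 (suc n))) (*-identityʳ _))))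
absorb (suc n) (suc k) = begin
  suc (suc k) * (suc (suc n) C suc (suc k))
    ≡⟨ cong (suc (suc k) *_) (nCk+nC[k+1]≡[n+1]C[k+1] (suc n) (suc k)) ⟨
  suc (suc k) * (x + suc n C suc (suc k))
    ≡⟨ *-distribˡ-+ (suc (suc k)) x _ ⟩
  x + suc k * x + suc (suc k) * (suc n C suc (suc k))
    ≡⟨ cong₂ (λ a b → x + a + b) (absorb n k) (absorb n (suc k)) ⟩
  x + suc n * (n C k) + suc n * (n C suc k)
    ≡⟨ +-assoc x _ _ ⟩
  x + (suc n * (n C k) + suc n * (n C suc k))
    ≡⟨ cong (x +_) (trans (sym (*-distribˡ-+ (suc n) (n C k) _)) (cong (suc n *_) (nCk+nC[k+1]≡[n+1]C[k+1] n k))) ⟩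
  x + suc n * x ∎
  where
  open ≡-Reasoning
  x = suc n C suc k

-- Pascal's rule splits the left side of `absorb`, and the common term cancels. Writing N as m + k
-- avoids truncated subtraction.
ratioⁿ : ∀ m k → suc k * ((m + k) C suc k) ≡ m * ((m + k) C k)
ratioⁿ m k = +-cancelˡ-≡ (suc k * (N C k)) _ _ (begin
  suc k * (N C k) + suc k * (N C suc k) ≡⟨ *-distribˡ-+ (suc k) (N C k) _ ⟨
  suc k * (N C k + N C suc k)           ≡⟨ cong (suc k *_) (nCk+nC[k+1]≡[n+1]C[k+1] N k) ⟩
  suc k * (suc N C suc k)               ≡⟨ absorb N k ⟩
  suc (m + k) * (N C k)                 ≡⟨ cong (λ z → suc z * (N C k)) (+-comm m k) ⟩
  (suc k + m) * (N C k)                 ≡⟨ *-distribʳ-+ (N C k) (suc k) m ⟩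
  suc k * (N C k) + m * (N C k)         ∎)
  where
  open ≡-Reasoning
  N = m + k

ratio : ∀ m k → pos (suc k) ℤ.* pos ((m + k) C suc k) ≡ pos m ℤ.* pos ((m + k) C k)
ratio m k = trans (sym (ℤ.pos-* (suc k) _)) (trans (cong pos (ratioⁿ m k)) (ℤ.pos-* m _))

ratio-b : ∀ m k → pos (suc m) ℤ.* binom (m + k) k 1 ≡ pos k ℤ.* pos ((m + k) C k)
ratio-b m zero    = ℤ.*-zeroʳ (pos (suc m))
ratio-b m (suc k) rewrite +-suc m k = sym (ratio (suc m) k)

module _ (m k : ℕ) where
  private
    N = m + k
    a b c d e : ℤ
    a = binom N k 2
    b = binom N k 1
    c = pos (N C k)
    d = pos (N C suc k)
    e = pos (N C suc (suc k))

  ratio-a : pos (suc (suc m)) ℤ.* (pos (suc m) ℤ.* a) ≡ (pos k ℤ.- 1ℤ) ℤ.* (pos k ℤ.* c)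
  ratio-a = trans (commute (pos (suc (suc m))) (pos (suc m)) a)
    (trans (cong (pos (suc m) ℤ.*_) (a-b m k)) (trans (commute (pos (suc m)) (pos k ℤ.- 1ℤ) b)
      (cong ((pos k ℤ.- 1ℤ) ℤ.*_) (ratio-b m k))))
    where
    commute : ∀ x y z → x ℤ.* (y ℤ.* z) ≡ y ℤ.* (x ℤ.* z)
    commute = solve-∀
    a-b : ∀ m k → pos (suc (suc m)) ℤ.* binom (m + k) k 2 ≡ (pos k ℤ.- 1ℤ) ℤ.* binom (m + k) k 1
    -- At k = 0 both binomials vanish, so the factor -1 does no harm.
    a-b m zero    = ℤ.*-zeroʳ (pos (suc (suc m)))
    a-b m (suc k) rewrite +-suc m k = ratio-b (suc m) k

  ratio-e : pos (suc (suc k)) ℤ.* (pos (suc k) ℤ.* e) ≡ (pos m ℤ.- 1ℤ) ℤ.* (pos m ℤ.* c)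
  ratio-e = trans (commute (pos (suc (suc k))) (pos (suc k)) e)
    (trans (cong (pos (suc k) ℤ.*_) (e-d m)) (trans (commute (pos (suc k)) (pos m ℤ.- 1ℤ) d)
      (cong ((pos m ℤ.- 1ℤ) ℤ.*_) (ratio m k))))
    where
    commute : ∀ x y z → x ℤ.* (y ℤ.* z) ≡ y ℤ.* (x ℤ.* z)
    commute = solve-∀
    e-d : ∀ m → pos (suc (suc k)) ℤ.* pos ((m + k) C suc (suc k)) ≡ (pos m ℤ.- 1ℤ) ℤ.* pos ((m + k) C suc k)
    -- At m = 0 the factor is -1 again, and both binomials lie beyond the row and vanish.
    e-d zero rewrite k>n⇒nCk≡0 {k} {suc (suc k)} (m<n⇒m<1+n (n<1+n k)) | k>n⇒nCk≡0 {k} {suc k} (n<1+n k) =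
      ℤ.*-zeroʳ (pos (suc (suc k)))
    e-d (suc m) = subst (λ N → pos (suc (suc k)) ℤ.* pos (N C suc (suc k)) ≡ pos m ℤ.* pos (N C suc k))
                        (+-suc m k) (ratio m (suc k))

  choose-two : pos 2 ℤ.* pos (suc (suc N) C 2) ≡ (pos 2 ℤ.+ pos m ℤ.+ pos k) ℤ.* (1ℤ ℤ.+ pos m ℤ.+ pos k)
  choose-two = trans (sym (ℤ.pos-* 2 (suc (suc N) C 2)))
    (trans (cong pos (trans (absorb (suc N) 1) (cong (suc (suc N) *_) (nC1≡n (suc N)))))
           (ℤ.pos-* (suc (suc N)) (suc N)))

  -- At t = 2, 1, 0 the left side is C(N+2, k), C(N+2, k+1), C(N+2, k+2), which brings in the sums
  -- of `product₀`, `product₁`, `product₂`.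
  pascal² : ∀ t → binom (suc (suc N)) (suc (suc k)) t ≡
    (binom N (suc (suc k)) t ℤ.+ binom N (suc (suc k)) (suc t)) ℤ.+
    (binom N (suc (suc k)) (suc t) ℤ.+ binom N (suc (suc k)) (suc (suc t)))
  pascal² t = trans (pascal (suc N) (suc (suc k)) t)
    (cong₂ ℤ._+_ (pascal N (suc (suc k)) t) (pascal N (suc (suc k)) (suc t)))

  -- From k, k + 1, k + 2 the matrix is Toeplitz, with rows (c, b, a), (d, c, b), (e, d, c). The
  -- factor 2 · `scaling` is a product of positive integers and cancels.
  closed-formᶻ : binom-det N k (suc k) (suc (suc k)) ℤ.* pos (suc (suc N)) ℤ.* pos (suc (suc N) C 2) ≡
    pos (suc (suc N) C k) ℤ.* pos (suc (suc N) C suc k) ℤ.* pos (suc (suc N) C suc (suc k))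
  closed-formᶻ = trans
    (ℤ.*-cancelˡ-≡ (pos 2 ℤ.* scaling (pos m) (pos k) a b c d e ratio-a (ratio-b m k) (ratio m k) ratio-e) _ _
      (scaled-identity (pos m) (pos k) a b c d e ratio-a (ratio-b m k) (ratio m k) ratio-e (pos (suc (suc N) C 2)) choose-two))
    (sym (cong₂ ℤ._*_ (cong₂ ℤ._*_ (pascal² 2) (pascal² 1)) (pascal² 0)))

  closed-form : walks N 0 0 k * (suc (suc N) C 1) * (suc (suc N) C 2) ≡
    (suc (suc N) C k) * (suc (suc N) C suc k) * (suc (suc N) C suc (suc k))
  closed-form = ℤ.+-injective (trans (pos-*³ (walks N 0 0 k) (suc (suc N) C 1) (suc (suc N) C 2))
    (trans (cong₂ (λ x y → x ℤ.* y ℤ.* pos (suc (suc N) C 2)) (walks-det N refl refl) (cong pos (nC1≡n (suc (suc N)))))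
    (trans closed-formᶻ (sym (pos-*³ (suc (suc N) C k) _ _)))))
    where
    pos-*³ : ∀ x y z → pos (x * y * z) ≡ pos x ℤ.* pos y ℤ.* pos z
    pos-*³ x y z = trans (ℤ.pos-* (x * y) z) (cong (ℤ._* pos z) (ℤ.pos-* x y))

-- Summation to the Baxter number

Σ<-cong : ∀ n {f g} → (∀ k → k < n → f k ≡ g k) → Σ< n f ≡ Σ< n g
Σ<-cong zero    eq = refl
Σ<-cong (suc n) eq = cong₂ _+_ (eq 0 (s≤s z≤n)) (Σ<-cong n (λ k k<n → eq (suc k) (s≤s k<n)))

Σ<-*ʳ : ∀ n f c → Σ< n f * c ≡ Σ< n (λ k → f k * c)
Σ<-*ʳ zero    f c = refl
Σ<-*ʳ (suc n) f c = trans (*-distribʳ-+ c (f 0) _) (cong (f 0 * c +_) (Σ<-*ʳ n (f ∘ suc) c))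

baxter : ∀ N → Σ< (suc N) (walks N 0 0) * ((suc N + 1) C 1) * ((suc N + 1) C 2) ≡ baxterSum (suc N)
baxter N = begin
  Σ< (suc N) (walks N 0 0) * (N+2 C 1) * (N+2 C 2)
    ≡⟨ cong (_* (N+2 C 2)) (Σ<-*ʳ (suc N) (walks N 0 0) (N+2 C 1)) ⟩
  Σ< (suc N) (λ k → walks N 0 0 k * (N+2 C 1)) * (N+2 C 2)
    ≡⟨ Σ<-*ʳ (suc N) (λ k → walks N 0 0 k * (N+2 C 1)) (N+2 C 2) ⟩
  Σ< (suc N) (λ k → walks N 0 0 k * (N+2 C 1) * (N+2 C 2))
    ≡⟨ Σ<-cong (suc N) term ⟩
  Σ< (suc N) (λ k → (N+2 C k) * (N+2 C (k + 1)) * (N+2 C (k + 2)))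
    ≡⟨ cong sum (map-upTo _ (suc N)) ⟨
  baxterSum (suc N) ∎
  where
  open ≡-Reasoning
  N+2 = suc N + 1
  term : ∀ k → k < suc N → walks N 0 0 k * (N+2 C 1) * (N+2 C 2) ≡ (N+2 C k) * (N+2 C (k + 1)) * (N+2 C (k + 2))
  term k (s≤s k≤N) rewrite +-comm N 1 | +-comm k 1 | +-comm k 2 =
    -- As k ≤ N, `closed-form` applies with m = N ∸ k.
    subst (λ N → walks N 0 0 k * (suc (suc N) C 1) * (suc (suc N) C 2) ≡
                 (suc (suc N) C k) * (suc (suc N) C suc k) * (suc (suc N) C suc (suc k)))
          (m∸n+n≡m k≤N) (closed-form (N ∸ k) k)

theorem1p1 : (n : ℕ) → 1 ≤ n →
    Σ ℕ λ m → HasCardinality (LeftRightDiagram n) m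
    × (m * ((n + 1) C 1) * ((n + 1) C 2) ≡ baxterSum n)
theorem1p1 (suc N) _ = length (enum 1 N 0 0) , diagrams-cardinality N ,
  -- There are N = n - 1 gaps between the points, so M = n is large enough in `length-enum` and
  -- matches the range of the Baxter sum.
  trans (cong (λ m → m * ((suc N + 1) C 1) * ((suc N + 1) C 2)) (length-enum N (suc N) ≤-refl)) (baxter N)
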